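{- Let $n \ge 2$ be an integer and let $R_\infty = \mathbb{Z}[\{x_i\}_{i=1}^\infty]$ be the ring of polynomials with integer coefficients in countably many commuting indeterminates. Then $V(2^n) = v(2^n, R_\infty) = \infty$.
   Context: For a commutative ring $R$ with identity and a positive integer $k$, let $J(k,R)$ be the subring of $R$ generated by all $k$-th powers of elements of $R$. If there is an integer $v \ge 1$ such that every element $f \in J(k,R)$ can be written as $f = \sum_{i=1}^v \pm f_i^k$ for some $f_1,\ldots,f_v \in R$ and some choice of signs, let $v(k,R)$ be the smallest such $v$; if no such $v$ exists, set $v(k,R) = \infty$. Define $V(k)$ to be the supremum of $v(k,R)$ over all commutative rings $R$ with identity. -}

module Defs where

open import Level using (Level; _⊔_; 0ℓ) renaming (suc to lsuc)
open import Data.Nat using (ℕ; zero; suc; _≤_; _^_)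
open import Data.Bool using (Bool; true; false)
open import Data.Fin using (Fin) renaming (zero to fzero; suc to fsuc)
open import Data.Product using (Σ; _×_; _,_)
open import Relation.Nullary using (¬_)
open import Algebra.Bundles using (CommutativeRing)
open import Algebra.Structures using (IsCommutativeRing)

module _ {c ℓ : Level} (R : CommutativeRing c ℓ) where
  open CommutativeRing R

  pow : Carrier → ℕ → Carrier
  pow x zero    = 1#
  pow x (suc k) = x * pow x k

  data InJ (k : ℕ) : Carrier → Set (c ⊔ ℓ) where
    J-pow  : ∀ y → InJ k (pow y k)
    J-zero : InJ k 0#
    J-one  : InJ k 1#
    J-add  : ∀ {a b} → InJ k a → InJ k b → InJ k (a + b)
    J-neg  : ∀ {a} → InJ k a → InJ k (- a)
    J-mul  : ∀ {a b} → InJ k a → InJ k b → InJ k (a * b)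
    J-resp : ∀ {a b} → a ≈ b → InJ k a → InJ k b

  signedPowSum : (k v : ℕ) → (Fin v → Bool) → (Fin v → Carrier) → Carrier
  signedPowSum k zero    s f = 0#
  signedPowSum k (suc v) s f =
    term (s fzero) (pow (f fzero) k) + signedPowSum k v (λ i → s (fsuc i)) (λ i → f (fsuc i))
    where
    term : Bool → Carrier → Carrier
    term true  x = x
    term false x = - x

  RepresentableBy : (k v : ℕ) → Set (c ⊔ ℓ)
  RepresentableBy k v =
    ∀ g → InJ k g → Σ (Fin v → Bool) λ s → Σ (Fin v → Carrier) λ f → g ≈ signedPowSum k v s f

  vInfinite : ℕ → Set (c ⊔ ℓ)
  vInfinite k = ∀ v → 1 ≤ v → ¬ RepresentableBy k v

-- V(k) = ∞ : the supremum over all commutative rings of v(k,R) is infinite,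
-- i.e. for every v ≥ 1 there is a commutative ring R with v(k,R) > v.
VInfinite : ℕ → Set (lsuc 0ℓ)
VInfinite k = ∀ v → 1 ≤ v → Σ (CommutativeRing 0ℓ 0ℓ) λ R → ¬ RepresentableBy R k v

-- R∞ = ℤ[x_1, x_2, ...]: the free commutative ring on countably many
-- indeterminates, presented as ring terms modulo the congruence generated
-- by the commutative-ring axioms.

infixl 6 _⊕_
infixl 7 _⊗_
data Term : Set where
  var : ℕ → Term
  `0 `1 : Term
  _⊕_ _⊗_ : Term → Term → Term
  ⊝_ : Term → Term

infix 4 _≅_
data _≅_ : Term → Term → Set where
  ≅-refl  : ∀ {a} → a ≅ a
  ≅-sym   : ∀ {a b} → a ≅ b → b ≅ a
  ≅-trans : ∀ {a b d} → a ≅ b → b ≅ d → a ≅ d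
  ⊕-cong  : ∀ {a a' b b'} → a ≅ a' → b ≅ b' → a ⊕ b ≅ a' ⊕ b'
  ⊗-cong  : ∀ {a a' b b'} → a ≅ a' → b ≅ b' → a ⊗ b ≅ a' ⊗ b'
  ⊝-cong  : ∀ {a a'} → a ≅ a' → ⊝ a ≅ ⊝ a'
  ⊕-assoc : ∀ a b d → (a ⊕ b) ⊕ d ≅ a ⊕ (b ⊕ d)
  ⊕-comm  : ∀ a b → a ⊕ b ≅ b ⊕ a
  ⊕-idˡ   : ∀ a → `0 ⊕ a ≅ a
  ⊕-idʳ   : ∀ a → a ⊕ `0 ≅ a
  ⊝-invˡ  : ∀ a → (⊝ a) ⊕ a ≅ `0
  ⊝-invʳ  : ∀ a → a ⊕ (⊝ a) ≅ `0
  ⊗-assoc : ∀ a b d → (a ⊗ b) ⊗ d ≅ a ⊗ (b ⊗ d)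
  ⊗-comm  : ∀ a b → a ⊗ b ≅ b ⊗ a
  ⊗-idˡ   : ∀ a → `1 ⊗ a ≅ a
  ⊗-idʳ   : ∀ a → a ⊗ `1 ≅ a
  distˡ   : ∀ a b d → a ⊗ (b ⊕ d) ≅ (a ⊗ b) ⊕ (a ⊗ d)
  distʳ   : ∀ a b d → (b ⊕ d) ⊗ a ≅ (b ⊗ a) ⊕ (d ⊗ a)

R∞ : CommutativeRing 0ℓ 0ℓ
R∞ = record
  { Carrier = Term ; _≈_ = _≅_ ; _+_ = _⊕_ ; _*_ = _⊗_ ; -_ = ⊝_ ; 0# = `0 ; 1# = `1
  ; isCommutativeRing = record
    { isRing = record
      { +-isAbelianGroup = record
        { isGroup = record
          { isMonoid = record
            { isSemigroup = record
              { isMagma = record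
                { isEquivalence = record { refl = ≅-refl ; sym = ≅-sym ; trans = ≅-trans }
                ; ∙-cong = ⊕-cong }
              ; assoc = ⊕-assoc }
            ; identity = ⊕-idˡ , ⊕-idʳ }
          ; inverse = ⊝-invˡ , ⊝-invʳ
          ; ⁻¹-cong = ⊝-cong }
        ; comm = ⊕-comm }
      ; *-cong = ⊗-cong
      ; *-assoc = ⊗-assoc
      ; *-identity = ⊗-idˡ , ⊗-idʳ
      ; distrib = distˡ , distʳ }
    ; *-comm = ⊗-comm }
  }

{-# OPTIONS --safe #-}

-- Let k = 2ⁿ with n ≥ 2 and suppose Σᵢ (xᵢ + yᵢ)ᵏ = Σⱼ ±fⱼᵏ, with v terms on the right and more than
-- 2ᵛ terms on the left.  Since f(z)² ≡ f(z²) mod 2, passing to square roots of the variables gives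
-- Σᵢ (xᵢ + yᵢ)² ≡ Σⱼ ±fⱼ² mod 4.  Write a for the constant coefficient of fⱼ and c, b, e for those at
-- two distinct variables s, t and at s t.  Comparing coefficients of s t, the congruence mod 4 controls
-- Σⱼ (a e + c b) mod 2, while the original identity, divided by k, controls Σⱼ a (e + c b) mod 2 (this
-- needs k ≥ 4).  Adding the two eliminates e: modulo 2, Σⱼ (1 + a) c b is 1 for s t = xᵢ yᵢ and 0 for
-- s t = xₗ yᵢ with l ≠ i.  It depends on s only through the parities of the v numbers c, and by the
-- pigeonhole principle these agree for two of the xᵢ.

module Submission where

open import Defs
open import Algebra.Bundles using (CommutativeRing; AbelianGroup)
open import Algebra.Construct.DirectProduct using (abelianGroup)
open import Algebra.Morphism.Construct.Composition using (isRingHomomorphism)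
open import Algebra.Morphism.Structures using (module RingMorphisms)
import Algebra.Properties.CommutativeMonoid.Mult as CommutativeMonoidMult
import Algebra.Properties.Ring as RingProperties
import Algebra.Properties.Semiring.Mult as SemiringMult
import Algebra.Solver.Ring.NaturalCoefficients.Default as SemiringSolver
open import Algebra.Structures using (IsCommutativeRing)
open import Data.Bool using (Bool; true; false)
open import Data.Fin using (Fin; zero; suc; toℕ; fromℕ<; funToFin; finToFun)
open import Data.Fin.Properties using (toℕ-fromℕ<; toℕ-injective; toℕ<n; pigeonhole; finToFun-funToFin)
open import Data.Integer using (ℤ)
import Data.Integer as ℤ
open import Data.Integer.DivMod using (_%ℕ_; _/ℕ_; n%ℕd<d; a≡a%ℕn+[a/ℕn]*n)
import Data.Integer.Properties as ℤ
open import Data.Nat using (ℕ; zero; suc; _≤_; s≤s; _^_)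
import Data.Nat as ℕ
import Data.Nat.Properties as ℕ
open import Data.Product using (_×_; _,_; proj₁; proj₂)
open import Function using (_∘_)
open import Level using (0ℓ)
open import Relation.Binary.PropositionalEquality using (_≡_; _≢_; cong; cong₂; subst)
import Relation.Binary.PropositionalEquality as ≡
import Relation.Binary.Reasoning.Setoid as SetoidReasoning
open import Relation.Nullary using (¬_; Dec; yes; no; contradiction)

Ring₀ : Set₁
Ring₀ = CommutativeRing 0ℓ 0ℓ

∣_∣ : Ring₀ → Set
∣ R ∣ = CommutativeRing.Carrier R

-- Congruence modulo an integer in a commutative ring.

module Congruence (R : Ring₀) where
  open CommutativeRing R hiding (zero)
  open SemiringMult semiring renaming (_×_ to _×ₙ_)
  open CommutativeMonoidMult +-commutativeMonoid using (×-distrib-+)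
  open RingProperties ring using (-‿+-comm; -0#≈0#)
  open SemiringSolver commutativeSemiring
  open SetoidReasoning setoid

  infix 4 _≡_[mod_]
  -- The quotient is stored, so that a congruence in an extension ring with coordinatewise addition
  -- projects to congruences between coordinates.
  record _≡_[mod_] (x y : Carrier) (m : ℕ) : Set where
    constructor _,_
    field
      quotient : Carrier
      equality : x ≈ y + m ×ₙ quotient

  ×-zero : ∀ m → m ×ₙ 0# ≈ 0#
  ×-zero zero    = refl
  ×-zero (suc m) = trans (+-identityˡ _) (×-zero m)

  ×-neg : ∀ m x → m ×ₙ (- x) ≈ - (m ×ₙ x)
  ×-neg zero    x = sym -0#≈0#
  ×-neg (suc m) x = trans (+-congˡ (×-neg m x)) (-‿+-comm x (m ×ₙ x))

  mod-reflexive : ∀ {m x y} → x ≈ y → x ≡ y [mod m ]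
  mod-reflexive {m} {x} {y} x≈y =
    0# , trans x≈y (trans (sym (+-identityʳ y)) (+-congˡ (sym (×-zero m))))

  mod-sym : ∀ {m x y} → x ≡ y [mod m ] → y ≡ x [mod m ]
  mod-sym {m} {x} {y} (u , p) = - u , (begin
    y                            ≈⟨ +-identityʳ y ⟨
    y + 0#                       ≈⟨ +-congˡ (-‿inverseʳ (m ×ₙ u)) ⟨
    y + (m ×ₙ u + - (m ×ₙ u))    ≈⟨ +-assoc y _ _ ⟨
    y + m ×ₙ u + - (m ×ₙ u)      ≈⟨ +-cong p (×-neg m u) ⟨
    x + m ×ₙ (- u)               ∎)

  mod-trans : ∀ {m x y z} → x ≡ y [mod m ] → y ≡ z [mod m ] → x ≡ z [mod m ]
  mod-trans {m} {x} {y} {z} (u , p) (w , q) = w + u , (begin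
    x                        ≈⟨ p ⟩
    y + m ×ₙ u               ≈⟨ +-congʳ q ⟩
    z + m ×ₙ w + m ×ₙ u      ≈⟨ +-assoc z _ _ ⟩
    z + (m ×ₙ w + m ×ₙ u)    ≈⟨ +-congˡ (×-distrib-+ w u m) ⟨
    z + m ×ₙ (w + u)         ∎)

  mod-+ : ∀ {m x y x′ y′} → x ≡ y [mod m ] → x′ ≡ y′ [mod m ] → x + x′ ≡ y + y′ [mod m ]
  mod-+ {m} {x} {y} {x′} {y′} (u , p) (w , q) = u + w , (begin
    x + x′                              ≈⟨ +-cong p q ⟩
    y + m ×ₙ u + (y′ + m ×ₙ w)          ≈⟨ interchange y _ y′ _ ⟩
    y + y′ + (m ×ₙ u + m ×ₙ w)          ≈⟨ +-congˡ (×-distrib-+ u w m) ⟨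
    y + y′ + m ×ₙ (u + w)               ∎)
    where
    interchange : ∀ a b c d → a + b + (c + d) ≈ a + c + (b + d)
    interchange = solve 4 (λ a b c d → a :+ b :+ (c :+ d) := a :+ c :+ (b :+ d)) refl

  mod-neg : ∀ {m x y} → x ≡ y [mod m ] → - x ≡ - y [mod m ]
  mod-neg {m} {x} {y} (u , p) = - u , (begin
    - x                  ≈⟨ -‿cong p ⟩
    - (y + m ×ₙ u)       ≈⟨ -‿+-comm y _ ⟨
    - y + - (m ×ₙ u)     ≈⟨ +-congˡ (×-neg m u) ⟨
    - y + m ×ₙ (- u)     ∎)

  mod-*ˡ : ∀ {m} z {x y} → x ≡ y [mod m ] → z * x ≡ z * y [mod m ]
  mod-*ˡ {m} z {x} {y} (u , p) = z * u , (begin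
    z * x                ≈⟨ *-congˡ p ⟩
    z * (y + m ×ₙ u)     ≈⟨ distribˡ z y _ ⟩
    z * y + z * m ×ₙ u   ≈⟨ +-congˡ (×-comm-* m z u) ⟩
    z * y + m ×ₙ (z * u) ∎)

  mod-* : ∀ {m x y x′ y′} → x ≡ y [mod m ] → x′ ≡ y′ [mod m ] → x * x′ ≡ y * y′ [mod m ]
  mod-* {m} {x} {y} {x′} {y′} p q =
    mod-trans (mod-*ˡ x q)
      (mod-trans (mod-reflexive (*-comm x y′)) (mod-trans (mod-*ˡ y′ p) (mod-reflexive (*-comm y′ y))))

  mod-pow : ∀ {m x y} k → x ≡ y [mod m ] → pow R x k ≡ pow R y k [mod m ]
  mod-pow zero    p = mod-reflexive refl
  mod-pow (suc k) p = mod-* p (mod-pow k p)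

-- Powers and congruences modulo 4.

module Powers (R : Ring₀) where
  open CommutativeRing R hiding (zero)
  open Congruence R
  open SemiringSolver commutativeSemiring

  pow-cong : ∀ {x y} k → x ≈ y → pow R x k ≈ pow R y k
  pow-cong zero    p = refl
  pow-cong (suc k) p = *-cong p (pow-cong k p)

  pow-+ : ∀ x m n → pow R x (m ℕ.+ n) ≈ pow R x m * pow R x n
  pow-+ x zero    n = sym (*-identityˡ _)
  pow-+ x (suc m) n = trans (*-congˡ (pow-+ x m n)) (sym (*-assoc x _ _))

  pow-distrib-* : ∀ x y m → pow R (x * y) m ≈ pow R x m * pow R y m
  pow-distrib-* x y zero    = sym (*-identityˡ 1#)
  pow-distrib-* x y (suc m) = trans (*-congˡ (pow-distrib-* x y m))
    (solve 4 (λ x y a b → x :* y :* (a :* b) := x :* a :* (y :* b)) refl x y _ _)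

  pow-double : ∀ x m → pow R x (2 ℕ.* m) ≈ pow R x m * pow R x m
  pow-double x m = trans (pow-+ x m (m ℕ.+ 0)) (*-congˡ (trans (pow-+ x m 0) (*-identityʳ _)))

  pow-square : ∀ x m → pow R x (2 ℕ.* m) ≈ pow R (x * x) m
  pow-square x m = trans (pow-double x m) (sym (pow-distrib-* x x m))

  -- For x = y + 2u the square is y² + 4(y u + u²).
  square-mod4 : ∀ {x y} → x ≡ y [mod 2 ] → x * x ≡ y * y [mod 4 ]
  square-mod4 {x} {y} (u , p) = y * u + u * u , trans (*-cong p p)
    (solve 2 (λ y u → let d = u :+ (u :+ con 0)
                          e = y :* u :+ u :* u in
       (y :+ d) :* (y :+ d) := y :* y :+ (e :+ (e :+ (e :+ (e :+ con 0))))) refl y u)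

  -- The left side is the 2^n-th power of (x²)². One squaring lifts x² ≡ y from modulus 2 to modulus
  -- 4, which leaves y² to the power 2^n.
  pow-mod4 : ∀ {x y} n → x * x ≡ y [mod 2 ] → pow R x (2 ^ suc (suc n)) ≡ pow R y (2 ^ suc n) [mod 4 ]
  pow-mod4 {x} {y} n p =
    mod-trans (mod-reflexive (trans (pow-square x (2 ^ suc n)) (pow-square (x * x) (2 ^ n))))
      (mod-trans (mod-pow (2 ^ n) (square-mod4 p)) (mod-reflexive (sym (pow-square y (2 ^ n)))))

-- Signed sums.

module _ (R : Ring₀) where
  open CommutativeRing R hiding (zero)

  signed : Bool → Carrier → Carrier
  signed true  x = x
  signed false x = - x

  signedSum : ∀ {v} → (Fin v → Bool) → (Fin v → Carrier) → Carrier
  signedSum {zero}  s x = 0#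
  signedSum {suc v} s x = signed (s zero) (x zero) + signedSum (s ∘ suc) (x ∘ suc)

  -- The sign function local to `signedPowSum` reduces only at a known sign, hence the case split.
  -- Detaching the powers from the signs allows sums of arbitrary elements below.
  signedPowSum≡signedSum : ∀ k v s f → signedPowSum R k v s f ≡ signedSum s (λ i → pow R (f i) k)
  signedPowSum≡signedSum k zero    s f = ≡.refl
  signedPowSum≡signedSum k (suc v) s f with s zero
  ... | true  = cong (_ +_) (signedPowSum≡signedSum k v (s ∘ suc) (f ∘ suc))
  ... | false = cong (_ +_) (signedPowSum≡signedSum k v (s ∘ suc) (f ∘ suc))

module _ (A B : Ring₀) where
  private
    module A = CommutativeRing A
    module B = CommutativeRing B

  -- A single induction that serves equality, congruence, homomorphisms, scaling and coefficient
  -- extraction: each is a relation compatible with zero, sums and negation.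
  signedSum-rel : (_∼_ : A.Carrier → B.Carrier → Set) → A.0# ∼ B.0# →
    (∀ {x x′ y y′} → x ∼ y → x′ ∼ y′ → (x A.+ x′) ∼ (y B.+ y′)) →
    (∀ {x y} → x ∼ y → (A.- x) ∼ (B.- y)) →
    ∀ {v} (s : Fin v → Bool) {x y} → (∀ i → x i ∼ y i) → signedSum A s x ∼ signedSum B s y
  signedSum-rel _∼_ 0∼ +∼ -∼ = go
    where
    signed-rel : ∀ b {x y} → x ∼ y → signed A b x ∼ signed B b y
    signed-rel true  p = p
    signed-rel false p = -∼ p

    go : ∀ {v} (s : Fin v → Bool) {x y} → (∀ i → x i ∼ y i) → signedSum A s x ∼ signedSum B s y
    go {zero}  s p = 0∼
    go {suc v} s p = +∼ (signed-rel (s zero) (p zero)) (go (s ∘ suc) (p ∘ suc))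

module _ (R : Ring₀) where
  open CommutativeRing R hiding (zero)
  open Congruence R

  signedSum-cong : ∀ {v} (s : Fin v → Bool) {x y} → (∀ i → x i ≈ y i) → signedSum R s x ≈ signedSum R s y
  signedSum-cong = signedSum-rel R R _≈_ refl +-cong -‿cong

  signedSum-mod : ∀ {m v} (s : Fin v → Bool) {x y} → (∀ i → x i ≡ y i [mod m ]) →
    signedSum R s x ≡ signedSum R s y [mod m ]
  signedSum-mod {m} = signedSum-rel R R (_≡_[mod m ]) (mod-reflexive refl) mod-+ mod-neg

-- Ring homomorphisms and evaluation of terms.

IsHom : (A B : Ring₀) → (∣ A ∣ → ∣ B ∣) → Set
IsHom A B = RingMorphisms.IsRingHomomorphism (CommutativeRing.rawRing A) (CommutativeRing.rawRing B)

module Hom {A B : Ring₀} {h : ∣ A ∣ → ∣ B ∣} (isHom : IsHom A B h) where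
  private
    module A = CommutativeRing A
    module B = CommutativeRing B
  open RingMorphisms.IsRingHomomorphism isHom public

  pow-homo : ∀ x k → h (pow A x k) B.≈ pow B (h x) k
  pow-homo x zero    = 1#-homo
  pow-homo x (suc k) = B.trans (*-homo x _) (B.*-congˡ (pow-homo x k))

  signedSum-homo : ∀ {v} (s : Fin v → Bool) x → h (signedSum A s x) B.≈ signedSum B s (h ∘ x)
  signedSum-homo s x = signedSum-rel A B (λ a b → h a B.≈ b) 0#-homo
    (λ p q → B.trans (+-homo _ _) (B.+-cong p q))
    (λ p → B.trans (-‿homo _) (B.-‿cong p)) s (λ i → B.refl)

module Evaluation (R : Ring₀) where
  open CommutativeRing R hiding (zero)
  open Congruence R
  open RingProperties ring using (-‿distribˡ-*; -‿distribʳ-*; -‿involutive)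
  open SemiringSolver commutativeSemiring

  eval : (ℕ → Carrier) → Term → Carrier
  eval ρ (var i) = ρ i
  eval ρ `0      = 0#
  eval ρ `1      = 1#
  eval ρ (f ⊕ g) = eval ρ f + eval ρ g
  eval ρ (f ⊗ g) = eval ρ f * eval ρ g
  eval ρ (⊝ f)   = - eval ρ f

  module _ (ρ : ℕ → Carrier) where
    eval-cong : ∀ {f g} → f ≅ g → eval ρ f ≈ eval ρ g
    eval-cong ≅-refl          = refl
    eval-cong (≅-sym p)       = sym (eval-cong p)
    eval-cong (≅-trans p q)   = trans (eval-cong p) (eval-cong q)
    eval-cong (⊕-cong p q)    = +-cong (eval-cong p) (eval-cong q)
    eval-cong (⊗-cong p q)    = *-cong (eval-cong p) (eval-cong q)
    eval-cong (⊝-cong p)      = -‿cong (eval-cong p)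
    eval-cong (⊕-assoc a b d) = +-assoc _ _ _
    eval-cong (⊕-comm a b)    = +-comm _ _
    eval-cong (⊕-idˡ a)       = +-identityˡ _
    eval-cong (⊕-idʳ a)       = +-identityʳ _
    eval-cong (⊝-invˡ a)      = -‿inverseˡ _
    eval-cong (⊝-invʳ a)      = -‿inverseʳ _
    eval-cong (⊗-assoc a b d) = *-assoc _ _ _
    eval-cong (⊗-comm a b)    = *-comm _ _
    eval-cong (⊗-idˡ a)       = *-identityˡ _
    eval-cong (⊗-idʳ a)       = *-identityʳ _
    eval-cong (distˡ a b d)   = distribˡ _ _ _
    eval-cong (distʳ a b d)   = distribʳ _ _ _

    eval-isHom : IsHom R∞ R (eval ρ)
    eval-isHom = record
      { isSemiringHomomorphism = record
        { isNearSemiringHomomorphism = record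
          { +-isMonoidHomomorphism = record
            { isMagmaHomomorphism = record
              { isRelHomomorphism = record { cong = eval-cong }
              ; homo = λ _ _ → refl }
            ; ε-homo = refl }
          ; *-homo = λ _ _ → refl }
        ; 1#-homo = refl }
      ; -‿homo = λ _ → refl }

  neg-self-mod2 : ∀ x → x ≡ - x [mod 2 ]
  neg-self-mod2 x = x , sym (trans (sym (+-assoc _ _ _))
    (trans (+-congʳ (-‿inverseˡ x)) (trans (+-identityˡ _) (+-identityʳ x))))

  -- Frobenius modulo 2: squaring respects products, and respects sums up to the even cross term
  -- 2xy. For negation, (-x)² = x², while y ≡ -y on the other side.
  square-eval : ∀ {ρ ρ′} → (∀ i → ρ i * ρ i ≈ ρ′ i) → ∀ f → eval ρ f * eval ρ f ≡ eval ρ′ f [mod 2 ]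
  square-eval p (var i) = mod-reflexive (p i)
  square-eval p `0      = mod-reflexive (zeroˡ 0#)
  square-eval p `1      = mod-reflexive (*-identityˡ 1#)
  square-eval p (f ⊕ g) = mod-trans
    (_ , solve 2 (λ x y → (x :+ y) :* (x :+ y) := x :* x :+ y :* y :+ (x :* y :+ (x :* y :+ con 0)))
           refl _ _)
    (mod-+ (square-eval p f) (square-eval p g))
  square-eval p (f ⊗ g) = mod-trans
    (mod-reflexive (solve 2 (λ x y → (x :* y) :* (x :* y) := (x :* x) :* (y :* y)) refl _ _))
    (mod-* (square-eval p f) (square-eval p g))
  square-eval p (⊝ f)   = mod-trans
    (mod-reflexive (trans (sym (-‿distribˡ-* _ _)) (trans (-‿cong (sym (-‿distribʳ-* _ _))) (-‿involutive _))))
    (mod-trans (square-eval p f) (neg-self-mod2 _))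

module _ {A B : Ring₀} {h : ∣ A ∣ → ∣ B ∣} (isHom : IsHom A B h) where
  private
    module B = CommutativeRing B
    module EA = Evaluation A
    module EB = Evaluation B
  open Hom {A} {B} isHom

  eval-natural : ∀ ρ f → EB.eval (h ∘ ρ) f B.≈ h (EA.eval ρ f)
  eval-natural ρ (var i) = B.refl
  eval-natural ρ `0      = B.sym 0#-homo
  eval-natural ρ `1      = B.sym 1#-homo
  eval-natural ρ (f ⊕ g) = B.trans (B.+-cong (eval-natural ρ f) (eval-natural ρ g)) (B.sym (+-homo _ _))
  eval-natural ρ (f ⊗ g) = B.trans (B.*-cong (eval-natural ρ f) (eval-natural ρ g)) (B.sym (*-homo _ _))
  eval-natural ρ (⊝ f)   = B.trans (B.-‿cong (eval-natural ρ f)) (B.sym (-‿homo _))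

-- Adjoining a square root to a ring.

module _ (A : Ring₀) (d : ∣ A ∣) where
  open CommutativeRing A hiding (zero)
  open SemiringSolver commutativeSemiring
  private
    module G = AbelianGroup (abelianGroup +-abelianGroup +-abelianGroup)

    infixl 7 _·_
    _·_ : G.Carrier → G.Carrier → G.Carrier
    (x , y) · (x′ , y′) = x * x′ + d * (y * y′) , x * y′ + y * x′

    ·-comm : ∀ p q → p · q G.≈ q · p
    ·-comm (x , y) (x′ , y′) =
      solve 5 (λ d x y x′ y′ → x :* x′ :+ d :* (y :* y′) := x′ :* x :+ d :* (y′ :* y)) refl d x y x′ y′ ,
      solve 4 (λ x y x′ y′ → x :* y′ :+ y :* x′ := x′ :* y :+ y′ :* x) refl x y x′ y′

    ·-assoc : ∀ p q r → (p · q) · r G.≈ p · (q · r)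
    ·-assoc (x , y) (x′ , y′) (x″ , y″) =
      solve 7 (λ d x y x′ y′ x″ y″ →
        (x :* x′ :+ d :* (y :* y′)) :* x″ :+ d :* ((x :* y′ :+ y :* x′) :* y″) :=
        x :* (x′ :* x″ :+ d :* (y′ :* y″)) :+ d :* (y :* (x′ :* y″ :+ y′ :* x″))) refl d x y x′ y′ x″ y″ ,
      solve 7 (λ d x y x′ y′ x″ y″ →
        (x :* x′ :+ d :* (y :* y′)) :* y″ :+ (x :* y′ :+ y :* x′) :* x″ :=
        x :* (x′ :* y″ :+ y′ :* x″) :+ y :* (x′ :* x″ :+ d :* (y′ :* y″))) refl d x y x′ y′ x″ y″

    ·-identityˡ : ∀ p → (1# , 0#) · p G.≈ p
    ·-identityˡ (x , y) =
      solve 3 (λ d x y → con 1 :* x :+ d :* (con 0 :* y) := x) refl d x y ,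
      solve 2 (λ x y → con 1 :* y :+ con 0 :* x := y) refl x y

    ·-distribˡ : ∀ p q r → p · (q G.∙ r) G.≈ (p · q) G.∙ (p · r)
    ·-distribˡ (x , y) (x′ , y′) (x″ , y″) =
      solve 7 (λ d x y x′ y′ x″ y″ →
        x :* (x′ :+ x″) :+ d :* (y :* (y′ :+ y″)) :=
        x :* x′ :+ d :* (y :* y′) :+ (x :* x″ :+ d :* (y :* y″))) refl d x y x′ y′ x″ y″ ,
      solve 6 (λ x y x′ y′ x″ y″ →
        x :* (y′ :+ y″) :+ y :* (x′ :+ x″) :=
        x :* y′ :+ y :* x′ :+ (x :* y″ :+ y :* x″)) refl x y x′ y′ x″ y″

  -- Kept opaque: unfolding these proofs makes conversion checking in iterated extensions explode.
  abstract
    adjoinRoot-isCommutativeRing :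
      IsCommutativeRing G._≈_ G._∙_ _·_ G._⁻¹ G.ε (1# , 0#)
    adjoinRoot-isCommutativeRing = record
      { isRing = record
        { +-isAbelianGroup = G.isAbelianGroup
        ; *-cong = λ (p , q) (p′ , q′) →
            +-cong (*-cong p p′) (*-congˡ (*-cong q q′)) , +-cong (*-cong p q′) (*-cong q p′)
        ; *-assoc = ·-assoc
        ; *-identity = ·-identityˡ , λ p → G.trans (·-comm p _) (·-identityˡ p)
        ; distrib = ·-distribˡ , λ p q r →
            G.trans (·-comm _ p) (G.trans (·-distribˡ p q r) (G.∙-cong (·-comm p q) (·-comm p r)))
        }
      ; *-comm = ·-comm
      }

  -- A[√d], with (x , y) standing for x + y √d; d = 0 gives the dual numbers.
  adjoinRoot : Ring₀
  adjoinRoot = record { isCommutativeRing = adjoinRoot-isCommutativeRing }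

  √ : ∣ adjoinRoot ∣
  √ = 0# , 1#

  embed : Carrier → ∣ adjoinRoot ∣
  embed x = x , 0#

  √-square : √ · √ G.≈ embed d
  √-square = solve 1 (λ d → con 0 :* con 0 :+ d :* (con 1 :* con 1) := d) refl d ,
             solve 0 (con 0 :* con 1 :+ con 1 :* con 0 := con 0) refl

  embed-isHom : IsHom A adjoinRoot embed
  embed-isHom = record
    { isSemiringHomomorphism = record
      { isNearSemiringHomomorphism = record
        { +-isMonoidHomomorphism = record
          { isMagmaHomomorphism = record
            { isRelHomomorphism = record { cong = λ p → p , refl }
            ; homo = λ _ _ → refl , sym (+-identityˡ 0#) }
          ; ε-homo = G.refl }
        ; *-homo = λ x y →
            solve 3 (λ d x y → x :* y := x :* y :+ d :* (con 0 :* con 0)) refl d x y ,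
            solve 2 (λ x y → con 0 := x :* con 0 :+ con 0 :* y) refl x y }
      ; 1#-homo = G.refl }
    ; -‿homo = λ x → refl , sym -0#≈0# }
    where
    open RingProperties ring using (-0#≈0#)

-- Passing to square roots of the variables.

-- Only the coefficients at 1, at two variables and at their product will be compared, so all other
-- variables may vanish.
valuation : (R : Ring₀) → (p q : ℕ) → (s t : ∣ R ∣) → ℕ → ∣ R ∣
valuation R p q s t i with i ℕ.≟ p | i ℕ.≟ q
... | yes _ | _     = s
... | no _  | yes _ = t
... | no _  | no _  = CommutativeRing.0# R

module Descent {v w : ℕ} (σ : Fin v → Bool) (f : Fin v → Term) (τ : Fin w → Bool) (g : Fin w → Term)
               (p q : ℕ) where

  -- Quantifying over all rings and values carries the induction: `descend` uses the hypothesis in a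
  -- larger ring, at other values. Index 0 stands for squares.
  SumsCongruent : ℕ → Set₁
  SumsCongruent n = (A : Ring₀) (s t : ∣ A ∣) →
    let open Congruence A
        F = λ h → pow A (Evaluation.eval A (valuation A p q s t) h) (2 ^ suc n)
    in signedSum A σ (F ∘ f) ≡ signedSum A τ (F ∘ g) [mod 4 ]

  -- In C = A[√s][√t] the hypothesis is applied at √s and √t. By `pow-mod4` each power there is,
  -- modulo 4, the image of a power of half the exponent, taken at s and t in A.
  descend : ∀ n → SumsCongruent (suc n) → SumsCongruent n
  descend n hyp A s t =
    let u , e = mod-trans (mod-sym (sum-step σ f)) (mod-trans (hyp C s′ t′) (sum-step τ g))
    -- C is free over A on 1, √s, √t, √s√t, and `ι` lands in the coordinate of 1; projecting onto it
    -- returns the congruence to A.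
    in record { quotient = proj₁ (proj₁ u) ; equality = proj₁ (proj₁ e) }
    where
    B = adjoinRoot A s
    C = adjoinRoot B (embed A s t)
    module A = CommutativeRing A
    module C = CommutativeRing C
    s′ t′ : ∣ C ∣
    s′ = embed B (embed A s t) (√ A s)
    t′ = √ B (embed A s t)
    ι : ∣ A ∣ → ∣ C ∣
    ι = embed B (embed A s t) ∘ embed A s
    ι-isHom : IsHom A C ι
    ι-isHom = isRingHomomorphism C.trans (embed-isHom A s) (embed-isHom B (embed A s t))
    open Congruence C
    module ι = Hom {A} {C} {ι} ι-isHom
    module κ = Hom {B} {C} (embed-isHom B (embed A s t))

    valuation-square : ∀ i → valuation C p q s′ t′ i C.* valuation C p q s′ t′ i C.≈ ι (valuation A p q s t i)
    valuation-square i with i ℕ.≟ p | i ℕ.≟ q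
    ... | yes _ | _     = C.trans (C.sym (κ.*-homo (√ A s) (√ A s)))
                            (κ.⟦⟧-cong (√-square A s))
    ... | no _  | yes _ = √-square B (embed A s t)
    ... | no _  | no _  = C.zeroˡ C.0#

    F : Term → ∣ C ∣
    F h = pow C (Evaluation.eval C (valuation C p q s′ t′) h) (2 ^ suc (suc n))
    G : Term → ∣ A ∣
    G h = pow A (Evaluation.eval A (valuation A p q s t) h) (2 ^ suc n)

    step : ∀ h → F h ≡ ι (G h) [mod 4 ]
    step h = mod-trans
      (Powers.pow-mod4 C n (Evaluation.square-eval C valuation-square h))
      (mod-reflexive (C.trans (Powers.pow-cong C (2 ^ suc n) (eval-natural {A} {C} ι-isHom (valuation A p q s t) h))
        (C.sym (ι.pow-homo _ (2 ^ suc n)))))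

    sum-step : ∀ {v} (σ : Fin v → Bool) f → signedSum C σ (F ∘ f) ≡ ι (signedSum A σ (G ∘ f)) [mod 4 ]
    sum-step σ f = mod-trans (signedSum-mod C σ (step ∘ f))
      (mod-reflexive (C.sym (ι.signedSum-homo σ (G ∘ f))))

  descend* : ∀ n → SumsCongruent n → SumsCongruent 0
  descend* zero    hyp = hyp
  descend* (suc n) hyp = descend* n (descend n hyp)

-- Linearity of signed sums, and sums of powers.

allPlus : ∀ {w} → Fin w → Bool
allPlus _ = true

module _ (R : Ring₀) where
  open CommutativeRing R hiding (zero)
  open SemiringSolver commutativeSemiring
  open RingProperties ring using (-‿distribʳ-*; -‿+-comm)

  signedSum-*ˡ : ∀ c {v} (s : Fin v → Bool) x → signedSum R s (λ i → c * x i) ≈ c * signedSum R s x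
  signedSum-*ˡ c s x = signedSum-rel R R (λ a b → a ≈ c * b) (sym (zeroʳ c))
    (λ p q → trans (+-cong p q) (sym (distribˡ c _ _)))
    (λ p → trans (-‿cong p) (-‿distribʳ-* c _)) s (λ i → refl)

  signedSum-+ : ∀ {v} (s : Fin v → Bool) x y →
    signedSum R s (λ i → x i + y i) ≈ signedSum R s x + signedSum R s y
  signedSum-+ {zero}  s x y = sym (+-identityˡ 0#)
  signedSum-+ {suc v} s x y = trans
    (+-cong (signed-+ (s zero) (x zero) (y zero)) (signedSum-+ (s ∘ suc) (x ∘ suc) (y ∘ suc)))
    (solve 4 (λ a b c d → a :+ b :+ (c :+ d) := a :+ c :+ (b :+ d)) refl _ _ _ _)
    where
    signed-+ : ∀ b x y → signed R b (x + y) ≈ signed R b x + signed R b y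
    signed-+ true  x y = refl
    signed-+ false x y = sym (-‿+-comm x y)

  sum-zero : ∀ {w} (x : Fin w → Carrier) → (∀ i → x i ≈ 0#) → signedSum R allPlus x ≈ 0#
  sum-zero {zero}  x h = refl
  sum-zero {suc w} x h = trans (+-cong (h zero) (sum-zero (x ∘ suc) (h ∘ suc))) (+-identityˡ 0#)

  sum-single : ∀ {w} (x : Fin w → Carrier) m → (∀ i → i ≢ m → x i ≈ 0#) → signedSum R allPlus x ≈ x m
  sum-single x zero    h = trans (+-congˡ (sum-zero (x ∘ suc) (λ i → h (suc i) λ ()))) (+-identityʳ (x zero))
  sum-single x (suc m) h = trans
    (+-cong (h zero λ ()) (sum-single (x ∘ suc) m (λ i i≢m → h (suc i) λ { ≡.refl → i≢m ≡.refl })))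
    (+-identityˡ (x (suc m)))

  powerSum∈J : ∀ k {w} (f : Fin w → Carrier) → InJ R k (signedSum R allPlus (λ i → pow R (f i) k))
  powerSum∈J k {zero}  f = J-zero
  powerSum∈J k {suc w} f = J-add (J-pow (f zero)) (powerSum∈J k (f ∘ suc))

-- Coefficients at 1, s, t and s t.

module DualNumbers (Z : Ring₀) where
  open CommutativeRing Z hiding (zero)
  open SemiringSolver commutativeSemiring

  -- Z[s, t]/(s², t²), with a + c s + b t + e s t stored as ((a , c) , (b , e)).
  D₁ D₂ : Ring₀
  D₁ = adjoinRoot Z 0#
  D₂ = adjoinRoot D₁ (0# , 0#)

  private module D₂ = CommutativeRing D₂

  coeff₁ coeffₛ coeffₜ coeffₛₜ : ∣ D₂ ∣ → Carrier
  coeff₁  F = proj₁ (proj₁ F)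
  coeffₛ  F = proj₂ (proj₁ F)
  coeffₜ  F = proj₁ (proj₂ F)
  coeffₛₜ F = proj₂ (proj₂ F)

  two : Carrier
  two = 1# + 1#

  coeff₁-* : ∀ F G → coeff₁ (F D₂.* G) ≈ coeff₁ F * coeff₁ G
  coeff₁-* ((a , c) , (b , e)) ((a′ , c′) , (b′ , e′)) =
    solve 8 (λ a c b e a′ c′ b′ e′ →
      a :* a′ :+ con 0 :* (c :* c′) :+
        (con 0 :* (b :* b′ :+ con 0 :* (e :* e′)) :+ con 0 :* (con 0 :* (b :* e′ :+ e :* b′)))
      := a :* a′) refl a c b e a′ c′ b′ e′

  coeffₛ-* : ∀ F G → coeffₛ (F D₂.* G) ≈ coeff₁ F * coeffₛ G + coeffₛ F * coeff₁ G
  coeffₛ-* ((a , c) , (b , e)) ((a′ , c′) , (b′ , e′)) =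
    solve 8 (λ a c b e a′ c′ b′ e′ →
      a :* c′ :+ c :* a′ :+
        (con 0 :* (b :* e′ :+ e :* b′) :+ con 0 :* (b :* b′ :+ con 0 :* (e :* e′)))
      := a :* c′ :+ c :* a′) refl a c b e a′ c′ b′ e′

  coeffₜ-* : ∀ F G → coeffₜ (F D₂.* G) ≈ coeff₁ F * coeffₜ G + coeffₜ F * coeff₁ G
  coeffₜ-* ((a , c) , (b , e)) ((a′ , c′) , (b′ , e′)) =
    solve 8 (λ a c b e a′ c′ b′ e′ →
      a :* b′ :+ con 0 :* (c :* e′) :+ (b :* a′ :+ con 0 :* (e :* c′))
      := a :* b′ :+ b :* a′) refl a c b e a′ c′ b′ e′

  coeffₛₜ-square : ∀ F → coeffₛₜ (F D₂.* F) ≈ two * (coeff₁ F * coeffₛₜ F + coeffₛ F * coeffₜ F)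
  coeffₛₜ-square ((a , c) , (b , e)) =
    solve 4 (λ a c b e → a :* e :+ c :* b :+ (b :* c :+ e :* a) :=
                       (con 1 :+ con 1) :* (a :* e :+ c :* b)) refl a c b e

  module PowerCoefficients (F : ∣ D₂ ∣) where
    -- For k = 2^n these are a^k, a^(k-1) c, a^(k-1) b and a^(k-1) e + (k-1) a^(k-2) c b: the
    -- coefficients of F^k, with the factor k removed from all but the first. The recurrences avoid
    -- any division.
    α β γ δ : ℕ → Carrier
    α zero    = coeff₁ F
    α (suc n) = α n * α n
    β zero    = coeffₛ F
    β (suc n) = α n * β n
    γ zero    = coeffₜ F
    γ (suc n) = α n * γ n
    δ zero    = coeffₛₜ F
    δ (suc n) = α n * δ n + pow Z two n * (β n * γ n)

    -- Each squaring doubles the cross terms, which supplies the next factor 2. In the coefficient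
    -- of s t the product of two multiples of m leaves a spare m, recorded in `δ`.
    coefficients : ∀ n → pow D₂ F (2 ^ n) D₂.≈
      ((α n , pow Z two n * β n) , (pow Z two n * γ n , pow Z two n * δ n))
    coefficients zero =
      D₂.trans (D₂.*-identityʳ F)
        ((refl , sym (*-identityˡ _)) , (sym (*-identityˡ _) , sym (*-identityˡ _)))
    coefficients (suc n) =
      D₂.trans (Powers.pow-double D₂ F (2 ^ n)) (D₂.trans (D₂.*-cong (coefficients n) (coefficients n))
        ((coeff₁-* P P ,
          trans (coeffₛ-* P P) (cross (α n) m (β n))) ,
         (trans (coeffₜ-* P P) (cross (α n) m (γ n)) ,
          trans (coeffₛₜ-square P)
            (solve 5 (λ a m b c d → (con 1 :+ con 1) :* (a :* (m :* d) :+ m :* b :* (m :* c)) :=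
                                    (con 1 :+ con 1) :* m :* (a :* d :+ m :* (b :* c))) refl
              (α n) m (β n) (γ n) (δ n)))))
      where
      m = pow Z two n
      P : ∣ D₂ ∣
      P = (α n , m * β n) , (m * γ n , m * δ n)
      cross : ∀ a m b → a * (m * b) + m * b * a ≈ two * m * (a * b)
      cross = solve 3 (λ a m b → a :* (m :* b) :+ m :* b :* a := (con 1 :+ con 1) :* m :* (a :* b)) refl

  -- const f and lin p f are the coefficients of f at 1 and at the variable p.
  const : Term → Carrier
  const (var i) = 0#
  const `0      = 0#
  const `1      = 1#
  const (f ⊕ g) = const f + const g
  const (f ⊗ g) = const f * const g
  const (⊝ f)   = - const f

  indicator : ∀ {P : Set} → Dec P → Carrier
  indicator (yes _) = 1#
  indicator (no _)  = 0#

  indicator-yes : ∀ {P : Set} (d : Dec P) → P → indicator d ≈ 1#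
  indicator-yes (yes _) p = refl
  indicator-yes (no ¬p) p = contradiction p ¬p

  indicator-no : ∀ {P : Set} (d : Dec P) → ¬ P → indicator d ≈ 0#
  indicator-no (yes p) ¬p = contradiction p ¬p
  indicator-no (no _)  ¬p = refl

  lin : ℕ → Term → Carrier
  lin p (var i) = indicator (i ℕ.≟ p)
  lin p `0      = 0#
  lin p `1      = 0#
  lin p (f ⊕ g) = lin p f + lin p g
  lin p (f ⊗ g) = const f * lin p g + lin p f * const g
  lin p (⊝ f)   = - lin p f

  module Expansion {p q : ℕ} (p≢q : p ≢ q) where
    open Evaluation D₂ using (eval)

    ρ : ℕ → ∣ D₂ ∣
    ρ = valuation D₂ p q (embed D₁ (0# , 0#) (√ Z 0#)) (√ D₁ (0# , 0#))

    coeff₁-eval : ∀ f → coeff₁ (eval ρ f) ≈ const f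
    coeff₁-eval (var i) with i ℕ.≟ p | i ℕ.≟ q
    ... | yes _ | _     = refl
    ... | no _  | yes _ = refl
    ... | no _  | no _  = refl
    coeff₁-eval `0      = refl
    coeff₁-eval `1      = refl
    coeff₁-eval (f ⊕ g) = +-cong (coeff₁-eval f) (coeff₁-eval g)
    coeff₁-eval (f ⊗ g) = trans (coeff₁-* (eval ρ f) (eval ρ g)) (*-cong (coeff₁-eval f) (coeff₁-eval g))
    coeff₁-eval (⊝ f)   = -‿cong (coeff₁-eval f)

    coeffₛ-eval : ∀ f → coeffₛ (eval ρ f) ≈ lin p f
    coeffₛ-eval (var i) with i ℕ.≟ p | i ℕ.≟ q
    ... | yes _ | _     = refl
    ... | no _  | yes _ = refl
    ... | no _  | no _  = refl
    coeffₛ-eval `0      = refl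
    coeffₛ-eval `1      = refl
    coeffₛ-eval (f ⊕ g) = +-cong (coeffₛ-eval f) (coeffₛ-eval g)
    coeffₛ-eval (f ⊗ g) = trans (coeffₛ-* (eval ρ f) (eval ρ g))
      (+-cong (*-cong (coeff₁-eval f) (coeffₛ-eval g)) (*-cong (coeffₛ-eval f) (coeff₁-eval g)))
    coeffₛ-eval (⊝ f)   = -‿cong (coeffₛ-eval f)

    coeffₜ-eval : ∀ f → coeffₜ (eval ρ f) ≈ lin q f
    coeffₜ-eval (var i) with i ℕ.≟ p | i ℕ.≟ q
    -- `valuation` tests p first, so for p = q the variable would go to s and its coefficient at t
    -- would be lost.
    ... | yes i≡p | yes i≡q = contradiction (≡.trans (≡.sym i≡p) i≡q) p≢q
    ... | yes _   | no _    = refl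
    ... | no _    | yes _   = refl
    ... | no _    | no _    = refl
    coeffₜ-eval `0      = refl
    coeffₜ-eval `1      = refl
    coeffₜ-eval (f ⊕ g) = +-cong (coeffₜ-eval f) (coeffₜ-eval g)
    coeffₜ-eval (f ⊗ g) = trans (coeffₜ-* (eval ρ f) (eval ρ g))
      (+-cong (*-cong (coeff₁-eval f) (coeffₜ-eval g)) (*-cong (coeffₜ-eval f) (coeff₁-eval g)))
    coeffₜ-eval (⊝ f)   = -‿cong (coeffₜ-eval f)

  -- This is (1 + a) c b, which modulo 2 is the sum of a e + c b and a (e + c b).
  weight : ℕ → ℕ → Term → Carrier
  weight p q f = (1# + const f) * (lin p f * lin q f)

  -- The linear forms xᵢ + yᵢ.

  module Pairs (N : ℕ) where
    xᵢ yᵢ : Fin N → ℕ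
    xᵢ i = toℕ i
    yᵢ i = N ℕ.+ toℕ i

    pair : Fin N → Term
    pair i = var (xᵢ i) ⊕ var (yᵢ i)

    x≢y : ∀ i j → xᵢ i ≢ yᵢ j
    x≢y i j = ℕ.<⇒≢ (ℕ.<-≤-trans (toℕ<n i) (ℕ.m≤m+n N (toℕ j)))

    lin-x-pair : ∀ m i → lin (xᵢ m) (pair i) ≈ indicator (xᵢ i ℕ.≟ xᵢ m)
    lin-x-pair m i = trans (+-congˡ (indicator-no (yᵢ i ℕ.≟ xᵢ m) (x≢y m i ∘ ≡.sym))) (+-identityʳ _)

    lin-y-pair : ∀ m i → lin (yᵢ m) (pair i) ≈ indicator (yᵢ i ℕ.≟ yᵢ m)
    lin-y-pair m i = trans (+-congʳ (indicator-no (xᵢ i ℕ.≟ yᵢ m) (x≢y i m))) (+-identityˡ _)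

    lin-x-pair-≡ : ∀ m → lin (xᵢ m) (pair m) ≈ 1#
    lin-x-pair-≡ m = trans (lin-x-pair m m) (indicator-yes (xᵢ m ℕ.≟ xᵢ m) ≡.refl)

    lin-y-pair-≡ : ∀ m → lin (yᵢ m) (pair m) ≈ 1#
    lin-y-pair-≡ m = trans (lin-y-pair m m) (indicator-yes (yᵢ m ℕ.≟ yᵢ m) ≡.refl)

    lin-x-pair-≢ : ∀ m i → i ≢ m → lin (xᵢ m) (pair i) ≈ 0#
    lin-x-pair-≢ m i i≢m = trans (lin-x-pair m i) (indicator-no (xᵢ i ℕ.≟ xᵢ m) (i≢m ∘ toℕ-injective))

    lin-y-pair-≢ : ∀ m i → i ≢ m → lin (yᵢ m) (pair i) ≈ 0#
    lin-y-pair-≢ m i i≢m = trans (lin-y-pair m i)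
      (indicator-no (yᵢ i ℕ.≟ yᵢ m) (i≢m ∘ toℕ-injective ∘ ℕ.+-cancelˡ-≡ N _ _))

    -- Only the pair m contains the variable `yᵢ m`, and since its constant coefficient is 0 the
    -- factor 1 + a equals 1. The value is thus 1 for l = m and 0 otherwise.
    weight-sum : ∀ l m → signedSum Z allPlus (weight (xᵢ l) (yᵢ m) ∘ pair) ≈ lin (xᵢ l) (pair m)
    weight-sum l m = trans
      (sum-single Z _ m λ i i≢m →
        trans (*-congˡ (trans (*-congˡ (lin-y-pair-≢ m i i≢m)) (zeroʳ _))) (zeroʳ _))
      (trans (*-cong (trans (+-congˡ (+-identityˡ 0#)) (+-identityʳ 1#))
                     (trans (*-congˡ (lin-y-pair-≡ m)) (*-identityʳ _)))
        (*-identityˡ _))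

-- Arithmetic modulo 2.

bit : (Z : Ring₀) → Fin 2 → ∣ Z ∣
bit Z zero    = CommutativeRing.0# Z
bit Z (suc _) = CommutativeRing.1# Z

-- The properties of the integers on which the comparison of coefficients rests.
record Parity (Z : Ring₀) : Set where
  open CommutativeRing Z
  open Congruence Z
  open DualNumbers Z
  field
    two-cancelˡ : ∀ {x y} → two * x ≈ two * y → x ≈ y
    parity      : Carrier → Fin 2
    mod-parity  : ∀ x → x ≡ bit Z (parity x) [mod 2 ]

module _ (Z : Ring₀) (parityZ : Parity Z) where
  open CommutativeRing Z hiding (zero)
  open Congruence Z
  open DualNumbers Z
  open Parity parityZ
  open SemiringSolver commutativeSemiring

  private module D₂ = CommutativeRing D₂

  parity⇒mod : ∀ {x y} → parity x ≡ parity y → x ≡ y [mod 2 ]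
  parity⇒mod {x} {y} eq = mod-trans (mod-parity x)
    (subst (λ b → bit Z b ≡ y [mod 2 ]) (≡.sym eq) (mod-sym (mod-parity y)))

  square-mod2 : ∀ x → x * x ≡ x [mod 2 ]
  square-mod2 x = mod-trans (mod-* (mod-parity x) (mod-parity x))
    (mod-trans (mod-reflexive (bit-square (parity x))) (mod-sym (mod-parity x)))
    where
    bit-square : ∀ b → bit Z b * bit Z b ≈ bit Z b
    bit-square zero    = zeroˡ 0#
    bit-square (suc _) = *-identityˡ 1#

  drop-even : ∀ n x y → x + pow Z two (suc n) * y ≡ x [mod 2 ]
  drop-even n x y = pow Z two n * y ,
    solve 3 (λ x m y → x :+ (con 1 :+ con 1) :* m :* y := x :+ (m :* y :+ (m :* y :+ con 0)))
      refl x (pow Z two n) y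

  two^n-cancelˡ : ∀ n {x y} → pow Z two n * x ≈ pow Z two n * y → x ≈ y
  two^n-cancelˡ zero    eq = trans (sym (*-identityˡ _)) (trans eq (*-identityˡ _))
  two^n-cancelˡ (suc n) eq =
    two^n-cancelˡ n (two-cancelˡ (trans (sym (*-assoc _ _ _)) (trans eq (*-assoc _ _ _))))

  module _ (F : ∣ D₂ ∣) where
    open PowerCoefficients F

    α-mod2 : ∀ n → α n ≡ coeff₁ F [mod 2 ]
    α-mod2 zero    = mod-reflexive refl
    α-mod2 (suc n) = mod-trans (square-mod2 (α n)) (α-mod2 n)

    -- In a^(k-1) e + (k-1) a^(k-2) c b with k = 2^(n+2) both powers of a have positive exponent and
    -- k-1 is odd; as a² ≡ a, each power reduces to a. For k = 2 the term c b would lack the factor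
    -- a, so k ≥ 4 matters here.
    δ-mod2 : ∀ n → δ (suc (suc n)) ≡ coeff₁ F * (coeffₛₜ F + coeffₛ F * coeffₜ F) [mod 2 ]
    -- Up to an even term, `δ` at 2 is a² (a e + c b), and the factor a² reduces to a.
    δ-mod2 zero    = mod-trans (drop-even 0 _ _) (mod-trans
      (mod-* (α-mod2 1) (mod-reflexive (+-congˡ (*-identityˡ (coeffₛ F * coeffₜ F)))))
      (mod-trans (mod-reflexive
          (solve 3 (λ a e d → a :* (a :* e :+ d) := a :* a :* e :+ a :* d) refl (coeff₁ F) (coeffₛₜ F) _))
        (mod-trans (mod-+ (mod-* (square-mod2 (coeff₁ F)) (mod-reflexive refl)) (mod-reflexive refl))
          (mod-reflexive (sym (distribˡ _ _ _))))))
    δ-mod2 (suc n) = mod-trans (drop-even (suc n) _ _) (mod-trans (mod-* (α-mod2 (suc (suc n))) (δ-mod2 n))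
      (mod-trans (mod-reflexive (sym (*-assoc _ _ _))) (mod-* (square-mod2 (coeff₁ F)) (mod-reflexive refl))))

  -- Comparison of the coefficients of s t.

  module _ {v w : ℕ} (σ : Fin v → Bool) (f : Fin v → Term) (τ : Fin w → Bool) (g : Fin w → Term)
    (n : ℕ) (identity : signedSum R∞ σ (λ i → pow R∞ (f i) (2 ^ suc (suc n))) ≅
                        signedSum R∞ τ (λ i → pow R∞ (g i) (2 ^ suc (suc n)))) where

    eval-identity : (A : Ring₀) (ρ : ℕ → ∣ A ∣) → let open Evaluation A in
      CommutativeRing._≈_ A (signedSum A σ (λ i → pow A (eval ρ (f i)) (2 ^ suc (suc n))))
                            (signedSum A τ (λ i → pow A (eval ρ (g i)) (2 ^ suc (suc n))))
    eval-identity A ρ = A.trans (A.sym (eval-side σ f)) (A.trans (EA.eval-cong ρ identity) (eval-side τ g))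
      where
      module A = CommutativeRing A
      module EA = Evaluation A
      module H = Hom {R∞} {A} {EA.eval ρ} (EA.eval-isHom ρ)
      eval-side : ∀ {v} (σ : Fin v → Bool) f →
        EA.eval ρ (signedSum R∞ σ (λ i → pow R∞ (f i) (2 ^ suc (suc n)))) A.≈
        signedSum A σ (λ i → pow A (EA.eval ρ (f i)) (2 ^ suc (suc n)))
      eval-side σ f = A.trans (H.signedSum-homo σ _)
        (signedSum-cong A σ (λ i → H.pow-homo (f i) (2 ^ suc (suc n))))

    module _ {p q : ℕ} (p≢q : p ≢ q) where
      open Expansion p≢q
      open Evaluation D₂ using (eval)

      coeffₛₜ-sum : ∀ c {v} (σ : Fin v → Bool) {F : Fin v → ∣ D₂ ∣} {x : Fin v → Carrier} →
        (∀ i → coeffₛₜ (F i) ≈ c * x i) → coeffₛₜ (signedSum D₂ σ F) ≈ c * signedSum Z σ x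
      coeffₛₜ-sum c σ {x = x} h = trans
        (signedSum-rel D₂ Z (λ a b → coeffₛₜ a ≈ b) refl +-cong -‿cong σ h)
        (signedSum-*ˡ Z c σ x)

      -- The coefficients of s t in h² and hᵏ, divided by 2 and by k; the latter only modulo 2.
      squareTerm : Term → Carrier
      squareTerm h = const h * coeffₛₜ (eval ρ h) + lin p h * lin q h

      powerTerm : Term → Carrier
      powerTerm h = const h * (coeffₛₜ (eval ρ h) + lin p h * lin q h)

      -- The exact identity is in particular a congruence modulo 4; n + 1 descents turn its powers
      -- into squares, and the result is read in `D₂` at the generators s and t.
      squareTerm-sums : signedSum Z σ (squareTerm ∘ f) ≡ signedSum Z τ (squareTerm ∘ g) [mod 2 ]
      squareTerm-sums = halve (Descent.descend* σ f τ g p q (suc n)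
        (λ A s t → Congruence.mod-reflexive A (eval-identity A (valuation A p q s t))) D₂ _ _)
        where
        square : ∀ h → coeffₛₜ (pow D₂ (eval ρ h) 2) ≈ two * squareTerm h
        square h = trans (proj₂ (proj₂ (D₂.*-congˡ {eval ρ h} (D₂.*-identityʳ (eval ρ h)))))
          (trans (coeffₛₜ-square (eval ρ h))
            (*-congˡ (+-cong (*-congʳ (coeff₁-eval h)) (*-cong (coeffₛ-eval h) (coeffₜ-eval h)))))

        halve : Congruence._≡_[mod_] D₂ (signedSum D₂ σ (λ i → pow D₂ (eval ρ (f i)) 2))
                                        (signedSum D₂ τ (λ i → pow D₂ (eval ρ (g i)) 2)) 4 →
                signedSum Z σ (squareTerm ∘ f) ≡ signedSum Z τ (squareTerm ∘ g) [mod 2 ]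
        -- The coefficient of s t gives 2x = 2y + 4u; cancelling 2 leaves a congruence modulo 2.
        halve record { quotient = u ; equality = eq } = coeffₛₜ u , two-cancelˡ (
          trans (sym (coeffₛₜ-sum two σ (square ∘ f)))
            (trans (proj₂ (proj₂ eq))
              (trans (+-congʳ (coeffₛₜ-sum two τ (square ∘ g)))
                (solve 2 (λ x d → (con 1 :+ con 1) :* x :+ (d :+ (d :+ (d :+ (d :+ con 0)))) :=
                                  (con 1 :+ con 1) :* (x :+ (d :+ (d :+ con 0)))) refl _ (coeffₛₜ u)))))

      -- Here the identity is used undescended: its coefficients of s t are exactly equal and share
      -- the factor 2^(n+2), which is cancelled before reducing modulo 2.
      powerTerm-sums : signedSum Z σ (powerTerm ∘ f) ≡ signedSum Z τ (powerTerm ∘ g) [mod 2 ]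
      powerTerm-sums = mod-trans (mod-sym (signedSum-mod Z σ (δ≡powerTerm ∘ f)))
        (mod-trans (mod-reflexive δ-sums) (signedSum-mod Z τ (δ≡powerTerm ∘ g)))
        where
        open PowerCoefficients

        δ≡powerTerm : ∀ h → δ (eval ρ h) (suc (suc n)) ≡ powerTerm h [mod 2 ]
        δ≡powerTerm h = mod-trans (δ-mod2 (eval ρ h) n) (mod-reflexive
          (*-cong (coeff₁-eval h) (+-congˡ (*-cong (coeffₛ-eval h) (coeffₜ-eval h)))))

        δ-sum : ∀ {v} (σ : Fin v → Bool) f →
          coeffₛₜ (signedSum D₂ σ (λ i → pow D₂ (eval ρ (f i)) (2 ^ suc (suc n)))) ≈
          pow Z two (suc (suc n)) * signedSum Z σ (λ i → δ (eval ρ (f i)) (suc (suc n)))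
        δ-sum σ f = coeffₛₜ-sum (pow Z two (suc (suc n))) σ
          (λ i → proj₂ (proj₂ (coefficients (eval ρ (f i)) (suc (suc n)))))

        δ-sums : signedSum Z σ (λ i → δ (eval ρ (f i)) (suc (suc n))) ≈
                 signedSum Z τ (λ i → δ (eval ρ (g i)) (suc (suc n)))
        δ-sums = two^n-cancelˡ (suc (suc n))
          (trans (sym (δ-sum σ f)) (trans (proj₂ (proj₂ (eval-identity D₂ ρ))) (δ-sum τ g)))

      -- The product a e occurs in both summands, so it becomes even and e drops out.
      squareTerm+powerTerm : ∀ h → squareTerm h + powerTerm h ≡ weight p q h [mod 2 ]
      squareTerm+powerTerm h = const h * coeffₛₜ (eval ρ h) ,
        solve 3 (λ a e d → a :* e :+ d :+ a :* (e :+ d) :=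
                           (con 1 :+ a) :* d :+ (a :* e :+ (a :* e :+ con 0)))
          refl (const h) (coeffₛₜ (eval ρ h)) (lin p h * lin q h)

      -- The coefficient e ties p and q together. Without it, p enters each summand only through the
      -- factor `lin p`, which makes a pigeonhole argument on p possible.
      weight-sums : signedSum Z σ (weight p q ∘ f) ≡ signedSum Z τ (weight p q ∘ g) [mod 2 ]
      weight-sums = mod-trans (mod-sym (side σ f))
        (mod-trans (mod-+ squareTerm-sums powerTerm-sums) (side τ g))
        where
        side : ∀ {v} (σ : Fin v → Bool) f →
          signedSum Z σ (squareTerm ∘ f) + signedSum Z σ (powerTerm ∘ f) ≡
          signedSum Z σ (weight p q ∘ f) [mod 2 ]
        side σ f = mod-trans (mod-reflexive (sym (signedSum-+ Z σ (squareTerm ∘ f) (powerTerm ∘ f))))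
          (signedSum-mod Z σ (squareTerm+powerTerm ∘ f))

  -- The pigeonhole argument.

  representable⇒1≡0 : ∀ n v → RepresentableBy R∞ (2 ^ suc (suc n)) v → 1# ≡ 0# [mod 2 ]
  representable⇒1≡0 n v rep
    -- One pair more than there are parity vectors of length v.
    with rep _ (powerSum∈J R∞ (2 ^ suc (suc n)) (Pairs.pair (suc (2 ^ v))))
  ... | σ , f , eq
    -- `funToFin` encodes the v parities belonging to `xᵢ l` as a number below 2^v.
    with pigeonhole (ℕ.n<1+n (2 ^ v)) (λ l → funToFin (λ j → parity (lin (toℕ l) (f j))))
  ... | l , m , l<m , same-code =
    -- From 1, the weight sum of the pairs at (xₘ, yₘ), to the sum over f there, then to the sum
    -- over f at (xₗ, yₘ), and back to the pairs, where it is 0.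
    mod-trans (mod-reflexive (sym (trans (weight-sum m m) (lin-x-pair-≡ m))))
      (mod-trans (mod-sym (sums (x≢y m m)))
        (mod-trans (mod-sym (signedSum-mod Z σ same-weight))
          (mod-trans (sums (x≢y l m))
            (mod-reflexive (trans (weight-sum l m) (lin-x-pair-≢ l m m≢l))))))
    where
    open Pairs (suc (2 ^ v))

    m≢l : m ≢ l
    m≢l m≡l = ℕ.<⇒≢ l<m (≡.sym (cong toℕ m≡l))

    same-parity : ∀ j → parity (lin (xᵢ l) (f j)) ≡ parity (lin (xᵢ m) (f j))
    same-parity j = ≡.trans (≡.sym (finToFun-funToFin _ j))
      (≡.trans (cong (λ c → finToFun c j) same-code) (finToFun-funToFin _ j))

    same-weight : ∀ j → weight (xᵢ l) (yᵢ m) (f j) ≡ weight (xᵢ m) (yᵢ m) (f j) [mod 2 ]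
    same-weight j = mod-* (mod-reflexive refl) (mod-* (parity⇒mod (same-parity j)) (mod-reflexive refl))

    sums : ∀ {p q} → p ≢ q → signedSum Z σ (weight p q ∘ f) ≡ signedSum Z allPlus (weight p q ∘ pair) [mod 2 ]
    sums = weight-sums σ f allPlus pair n
      (subst (_≅ _) (signedPowSum≡signedSum R∞ (2 ^ suc (suc n)) v σ f) (≅-sym eq))

-- The integers as coefficient ring, and the conclusion.

ℤ-ring : Ring₀
ℤ-ring = ℤ.+-*-commutativeRing

open import Data.Integer using (+_)
open Congruence ℤ-ring

ℤ-residue : ℤ → Fin 2
ℤ-residue x = fromℕ< (n%ℕd<d x 2)

ℤ-mod-residue : ∀ x → x ≡ bit ℤ-ring (ℤ-residue x) [mod 2 ]
ℤ-mod-residue x = x /ℕ 2 , (begin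
  x
    ≡⟨ a≡a%ℕn+[a/ℕn]*n x 2 ⟩
  + (x %ℕ 2) ℤ.+ q ℤ.* + 2
    ≡⟨ cong₂ (λ r d → + r ℤ.+ d) (toℕ-fromℕ< (n%ℕd<d x 2)) (double q) ⟨
  + toℕ (ℤ-residue x) ℤ.+ (q ℤ.+ (q ℤ.+ + 0))
    ≡⟨ cong (ℤ._+ (q ℤ.+ (q ℤ.+ + 0))) (toℕ≡bit (ℤ-residue x)) ⟩
  bit ℤ-ring (ℤ-residue x) ℤ.+ (q ℤ.+ (q ℤ.+ + 0)) ∎)
  where
  open ≡.≡-Reasoning
  q = x /ℕ 2
  double : ∀ q → q ℤ.+ (q ℤ.+ + 0) ≡ q ℤ.* + 2
  double = solve 1 (λ q → q :+ (q :+ con 0) := q :* con 2) ≡.refl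
    where
    open SemiringSolver ℤ.+-*-commutativeSemiring
  toℕ≡bit : ∀ b → + toℕ b ≡ bit ℤ-ring b
  toℕ≡bit zero       = ≡.refl
  toℕ≡bit (suc zero) = ≡.refl

ℤ-parity : Parity ℤ-ring
ℤ-parity = record
  { two-cancelˡ = ℤ.*-cancelˡ-≡ (+ 2) _ _
  ; parity      = ℤ-residue
  ; mod-parity  = ℤ-mod-residue
  }

1≢0-mod2 : ¬ (+ 1 ≡ + 0 [mod 2 ])
-- The quotient 1 is split off because doubling `suc n` exposes a second `suc` only once n is known
-- to be zero or a successor.
1≢0-mod2 (+ zero , ())
1≢0-mod2 (+ suc zero , ())
1≢0-mod2 (+ suc (suc n) , ())
1≢0-mod2 (ℤ.-[1+ n ] , ())

R∞-notRepresentable : ∀ n v → ¬ RepresentableBy R∞ (2 ^ suc (suc n)) v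
R∞-notRepresentable n v rep = 1≢0-mod2 (representable⇒1≡0 ℤ-ring ℤ-parity n v rep)

theorem1p1 : (n : ℕ) → 2 ≤ n → VInfinite (2 ^ n) × vInfinite R∞ (2 ^ n)
theorem1p1 (suc (suc n)) (s≤s (s≤s _)) =
  -- The same ring `R∞` serves as witness for every v.
  (λ v _ → R∞ , R∞-notRepresentable n v) , (λ v _ → R∞-notRepresentable n v)
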